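{- For every $n\ge 2$, none of the unimodal spi-logics $\mathsf{SPi}+\{\iota^n_{fun}\}$, $\mathsf{SPi}+\{\iota_{refl},\iota^n_{fun}\}$, $\mathsf{SPi}+\{\iota_{trans},\iota^n_{fun}\}$, $\mathsf{SPi}+(\Sigma_{qo}\cup\{\iota^n_{fun}\})$ and $\mathsf{SPi}+(\Sigma_{equiv}\cup\{\iota^n_{fun}\})$ is complex.
   Context: Unimodal setting: one diamond $\Diamond$. Sp-formulas: built from propositional variables and $\top$ by $\wedge$ and $\Diamond$; sp-implications $\sigma\to\tau$. A SLO is an algebra $(A,\wedge,\top,\Diamond)$ with $(A,\wedge,\top)$ a meet-semilattice with top and $\Diamond$ monotone; it validates $\sigma\to\tau$ if $\sigma[\mathfrak a]\le\tau[\mathfrak a]$ for all valuations. Frames $(W,R)$ with standard Kripke semantics. For a set $\Sigma$, $\mathsf{SPi}+\Sigma$ is the set of sp-implications valid in all SLOs validating $\Sigma$ (a spi-logic). For a frame $\mathfrak F=(W,R)$, $\mathfrak F^\star=(2^W,\cap,W,\Diamond^+)$ with $\Diamond^+X=\{w\mid\exists v\in X,(w,v)\in R\}$. A spi-logic $L$ is complex if every SLO validating $L$ embeds (injectively, preserving $\wedge,\top,\Diamond$) into $\mathfrak F^\star$ for some frame $\mathfrak F$ validating $L$. Notation: $\iota_{refl}=(p\to\Diamond p)$, $\iota_{trans}=(\Diamond\Diamond p\to\Diamond p)$, $\iota_{sym}=(q\wedge\Diamond p\to\Diamond(p\wedge\Diamond q))$, $\Sigma_{qo}=\{\iota_{refl},\iota_{trans}\}$,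 $\Sigma_{equiv}=\{\iota_{refl},\iota_{trans},\iota_{sym}\}$, and for $P=\{p_0,\dots,p_n\}$, $\iota^n_{fun}=\big(\bigwedge_{Q\subseteq P,|Q|=n}\Diamond\bigwedge Q\to\Diamond\bigwedge P\big)$ (its frames are those where every point has at most $n$ successors). -}

module Defs where

open import Algebra.Core using (Op₁)
open import Algebra.Morphism.Definitions using (Homomorphic₀; Homomorphic₁; Homomorphic₂)
open import Data.Fin.Base using (toℕ)
import Data.Fin.Subset as Sub
open import Data.Fin.Subset using (Subset; inside; outside; ∣_∣)
open import Data.Fin.Subset.Properties using (_∈?_)
open import Data.List.Base using (List; []; _∷_; _++_; map; foldr; filter; allFin)
open import Data.Nat.Base using (ℕ; zero; suc)
open import Data.Nat.Properties using (_≟_)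
open import Data.Product.Base using (Σ-syntax; ∃-syntax; _×_; _,_; proj₁; proj₂)
import Data.Unit.Polymorphic.Base as Unit
import Data.Vec.Base as Vec
open import Function.Definitions using (Congruent; Injective)
open import Level using (Level; _⊔_; 0ℓ) renaming (suc to lsuc)
open import Relation.Binary.Core using (Rel)
open import Relation.Binary.Definitions using (Monotonic₁)
open import Relation.Binary.Lattice.Bundles using (BoundedMeetSemilattice)
open import Relation.Unary using (Pred; _∈_; _∩_; _∪_; ｛_｝; _⊆_; _≐_)
open import Relation.Unary.Polymorphic using (U)
open import Relation.Unary.Relation.Binary.Subset using (⊆-isPartialOrder)

private
  variable
    a c ℓ₁ ℓ₂ f : Level

infixr 7 _∧ˢ_
infix  8 ◇ˢ_
infix  4 _⇒_

data SpFormula : Set where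
  var  : ℕ → SpFormula
  ⊤ˢ   : SpFormula
  _∧ˢ_ : SpFormula → SpFormula → SpFormula
  ◇ˢ_  : SpFormula → SpFormula

record SpImplication : Set where
  constructor _⇒_
  field
    antecedent : SpFormula
    consequent : SpFormula

record SLO c ℓ₁ ℓ₂ : Set (lsuc (c ⊔ ℓ₁ ⊔ ℓ₂)) where
  field
    boundedMeetSemilattice : BoundedMeetSemilattice c ℓ₁ ℓ₂
  open BoundedMeetSemilattice boundedMeetSemilattice public
  field
    ◇      : Op₁ Carrier
    ◇-mono : Monotonic₁ _≤_ _≤_ ◇

module _ (A : SLO c ℓ₁ ℓ₂) where
  open SLO A

  eval : (ℕ → Carrier) → SpFormula → Carrier
  eval 𝔞 (var i)  = 𝔞 i
  eval 𝔞 ⊤ˢ       = ⊤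
  eval 𝔞 (σ ∧ˢ τ) = eval 𝔞 σ ∧ eval 𝔞 τ
  eval 𝔞 (◇ˢ σ)   = ◇ (eval 𝔞 σ)

  Validatesᴬ : SpImplication → Set (c ⊔ ℓ₂)
  Validatesᴬ (σ ⇒ τ) = ∀ (𝔞 : ℕ → Carrier) → eval 𝔞 σ ≤ eval 𝔞 τ

  ValidatesAllᴬ : Pred SpImplication a → Set (a ⊔ c ⊔ ℓ₂)
  ValidatesAllᴬ Γ = ∀ ι → ι ∈ Γ → Validatesᴬ ι

record Frame f : Set (lsuc f) where
  field
    W : Set f
    R : Rel W f

module _ (𝔉 : Frame f) where
  open Frame 𝔉

  Forces : (ℕ → Pred W f) → W → SpFormula → Set f
  Forces V w (var i)  = w ∈ V i
  Forces V w ⊤ˢ       = Unit.⊤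
  Forces V w (σ ∧ˢ τ) = Forces V w σ × Forces V w τ
  Forces V w (◇ˢ σ)   = ∃[ v ] (R w v × Forces V v σ)

  Validatesᶠ : SpImplication → Set (lsuc f)
  Validatesᶠ (σ ⇒ τ) = ∀ (V : ℕ → Pred W f) w → Forces V w σ → Forces V w τ

  ValidatesAllᶠ : Pred SpImplication a → Set (a ⊔ lsuc f)
  ValidatesAllᶠ Γ = ∀ ι → ι ∈ Γ → Validatesᶠ ι

  ◇⁺ : Pred W f → Pred W f
  ◇⁺ X w = ∃[ v ] (v ∈ X × R w v)

-- 2^W is Pred W f with extensional equality _≐_ and inclusion _⊆_; 𝔉 ⋆ lives one
-- universe above 𝔉, which is why SLO has independent levels.
_⋆ : Frame f → SLO (lsuc f) f f
_⋆ {f} 𝔉 = record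
  { boundedMeetSemilattice = record
    { Carrier = Pred W f
    ; _≈_     = _≐_
    ; _≤_     = _⊆_
    ; _∧_     = _∩_
    ; ⊤       = U
    ; isBoundedMeetSemilattice = record
      { isMeetSemilattice = record
        { isPartialOrder = ⊆-isPartialOrder
        ; infimum        = λ X Y → proj₁ , proj₂ , λ Z Z⊆X Z⊆Y z → Z⊆X z , Z⊆Y z
        }
      ; maximum = λ X _ → Unit.tt
      }
    }
  ; ◇      = ◇⁺ 𝔉
  ; ◇-mono = λ X⊆Y (v , v∈X , wRv) → v , X⊆Y v∈X , wRv
  }
  where open Frame 𝔉

record Embedding {c ℓ₁ ℓ₂ d m₁ m₂} (A : SLO c ℓ₁ ℓ₂) (B : SLO d m₁ m₂)
                 : Set (c ⊔ ℓ₁ ⊔ d ⊔ m₁) where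
  private
    module A = SLO A
    module B = SLO B
  field
    to        : A.Carrier → B.Carrier
    cong      : Congruent A._≈_ B._≈_ to
    injective : Injective A._≈_ B._≈_ to
    ∧-homo    : Homomorphic₂ A.Carrier B.Carrier B._≈_ to A._∧_ B._∧_
    ⊤-homo    : Homomorphic₀ A.Carrier B.Carrier B._≈_ to A.⊤ B.⊤
    ◇-homo    : Homomorphic₁ A.Carrier B.Carrier B._≈_ to A.◇ B.◇

-- The levels only say which universe the SLOs are drawn from. The resulting logic does
-- not depend on them, since the Lindenbaum algebra of Γ already exists at level 0ℓ.
SPi+ : ∀ c ℓ₁ ℓ₂ → Pred SpImplication 0ℓ → Pred SpImplication (lsuc (c ⊔ ℓ₁ ⊔ ℓ₂))
SPi+ c ℓ₁ ℓ₂ Γ ι = (A : SLO c ℓ₁ ℓ₂) → ValidatesAllᴬ A Γ → Validatesᴬ A ι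

-- f is independent of c, ℓ₁, ℓ₂: canonical frames built from subsets of an SLO live in
-- a higher universe than the SLO itself.
Complex : ∀ c ℓ₁ ℓ₂ f → Pred SpImplication a → Set (a ⊔ lsuc (c ⊔ ℓ₁ ⊔ ℓ₂ ⊔ f))
Complex c ℓ₁ ℓ₂ f L =
  (A : SLO c ℓ₁ ℓ₂) → ValidatesAllᴬ A L →
  Σ[ 𝔉 ∈ Frame f ] (ValidatesAllᶠ 𝔉 L × Embedding A (𝔉 ⋆))

ι-refl ι-trans ι-sym : SpImplication
ι-refl  = p ⇒ ◇ˢ p
  where p = var 0
ι-trans = ◇ˢ ◇ˢ p ⇒ ◇ˢ p
  where p = var 0
ι-sym   = q ∧ˢ ◇ˢ p ⇒ ◇ˢ (p ∧ˢ ◇ˢ q)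
  where p = var 0
        q = var 1

Σ-qo Σ-equiv : Pred SpImplication 0ℓ
Σ-qo    = ｛ ι-refl ｝ ∪ ｛ ι-trans ｝
Σ-equiv = ｛ ι-refl ｝ ∪ ｛ ι-trans ｝ ∪ ｛ ι-sym ｝

⋀ : List SpFormula → SpFormula
⋀ = foldr _∧ˢ_ ⊤ˢ

allSubsets : ∀ m → List (Subset m)
allSubsets zero    = Vec.[] ∷ []
allSubsets (suc m) = map (inside Vec.∷_) (allSubsets m) ++ map (outside Vec.∷_) (allSubsets m)

-- i ∈ Fin m stands for the variable p_i, so this is ⋀ Q for Q ⊆ {p_0, …, p_{m-1}}.
⋀ᵛ : ∀ {m} → Subset m → SpFormula
⋀ᵛ {m} Q = ⋀ (map (λ i → var (toℕ i)) (filter (_∈? Q) (allFin m)))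

ι-fun : ℕ → SpImplication
ι-fun n = ⋀ (map (λ Q → ◇ˢ ⋀ᵛ Q) (filter (λ Q → ∣ Q ∣ ≟ n) (allSubsets (suc n)))) ⇒ ◇ˢ ⋀ᵛ (Sub.⊤ {suc n})

{-# OPTIONS --safe #-}
-- One algebra refutes all five cases: the meet-semilattice M∞ of a bottom, a top and
-- infinitely many pairwise disjoint atoms, with ◇ 𝟘 = 𝟘 and ◇ x = 𝟙 otherwise.
-- It validates Σ-equiv, and it validates ι-fun n for n ≥ 2 because elements of M∞ that
-- meet pairwise have a common nonzero lower bound.  If M∞ embeds into 𝔉 ⋆, then every
-- point outside the image of 𝟘 sees a successor in the image of each atom, and these are
-- distinct since the atoms are disjoint; so 𝔉 cannot validate ι-fun n.
module Submission where

open import Defs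
open import Data.Fin.Base using (Fin; zero; suc; toℕ)
import Data.Fin.Properties as Fin
import Data.Fin.Subset as Sub
open import Data.Fin.Subset using (Subset; inside; outside; ∣_∣)
open import Data.Fin.Subset.Properties using (_∈?_; ∈⊤; ∣⊤∣≡n; ⊆⊤; ⊆-antisym)
open import Data.List.Base using ([]; _∷_; map; filter; allFin)
open import Data.List.Membership.Propositional using (_∈_)
open import Data.List.Membership.Propositional.Properties
  using (∈-allFin; ∈-filter⁺; ∈-map⁺; ∈-++⁺ˡ; ∈-++⁺ʳ)
open import Data.List.Relation.Unary.All as All using (All; []; _∷_)
import Data.List.Relation.Unary.All.Properties as All
open import Data.List.Relation.Unary.Any using (here; there)
open import Data.Nat.Base using (ℕ; suc; _≤_; s≤s)
open import Data.Nat.Properties using (_≟_; 1+n≢n)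
open import Data.Product.Base using (_×_; _,_; ∃-syntax; proj₁; proj₂)
open import Data.Sum.Base using (inj₁; inj₂)
open import Data.Unit.Polymorphic.Base using (tt)
import Data.Vec as Vec
open import Function.Base using (_∘_)
open import Level using (Level; _⊔_; 0ℓ; Lift; lift; lower)
open import Relation.Binary.PropositionalEquality.Core using (_≡_; _≢_; refl; sym; trans; cong; subst)
open import Relation.Nullary.Decidable.Core using (yes; no)
open import Relation.Nullary.Negation.Core using (¬_; contradiction)
open import Relation.Unary using (Pred; _∪_; ｛_｝) renaming (_∈_ to _∈ᵖ_; _⊆_ to _⊆ᵖ_)

private
  variable
    c ℓ₁ ℓ₂ f : Level

-- Enumerating and counting subsets of a finite set.

∈-allSubsets : ∀ {m} (Q : Subset m) → Q ∈ allSubsets m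
∈-allSubsets Vec.[] = here refl
∈-allSubsets (inside Vec.∷ Q) = ∈-++⁺ˡ (∈-map⁺ _ (∈-allSubsets Q))
∈-allSubsets {suc m} (outside Vec.∷ Q) =
  ∈-++⁺ʳ (map (inside Vec.∷_) (allSubsets m)) (∈-map⁺ _ (∈-allSubsets Q))

-- Otherwise `Q` would be the full set, which has `suc n` elements. Membership is decidable, so the
-- omitted index is obtained constructively.
∣Q∣≡n⇒∃∉ : ∀ {n} (Q : Subset (suc n)) → ∣ Q ∣ ≡ n → ∃[ k ] ¬ k Sub.∈ Q
∣Q∣≡n⇒∃∉ {n} Q ∣Q∣≡n = Fin.¬∀⟶∃¬ (suc n) (Sub._∈ Q) (_∈? Q) λ all∈Q →
  1+n≢n (trans (sym (∣⊤∣≡n (suc n)))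
    (trans (cong ∣_∣ (⊆-antisym (λ {i} _ → all∈Q i) (⊆⊤ {p = Q}))) ∣Q∣≡n))

-- Finite conjunctions as meets in a SLO.

module _ (A : SLO c ℓ₁ ℓ₂) (𝔞 : ℕ → SLO.Carrier A) where
  private module A = SLO A

  eval-⋀-lower : ∀ {σ Γ} → σ ∈ Γ → eval A 𝔞 (⋀ Γ) A.≤ eval A 𝔞 σ
  eval-⋀-lower (here refl) = A.x∧y≤x _ _
  eval-⋀-lower (there σ∈Γ) = A.trans (A.x∧y≤y _ _) (eval-⋀-lower σ∈Γ)

  eval-⋀-greatest : ∀ {x} Γ → All (λ σ → x A.≤ eval A 𝔞 σ) Γ → x A.≤ eval A 𝔞 (⋀ Γ)
  eval-⋀-greatest []      []       = A.maximum _
  eval-⋀-greatest (σ ∷ Γ) (p ∷ ps) = A.∧-greatest p (eval-⋀-greatest Γ ps)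

  eval-⋀ᵛ-lower : ∀ {m} {Q : Subset m} {i} → i Sub.∈ Q → eval A 𝔞 (⋀ᵛ Q) A.≤ 𝔞 (toℕ i)
  eval-⋀ᵛ-lower {Q = Q} {i} i∈Q =
    eval-⋀-lower (∈-map⁺ (var ∘ toℕ) (∈-filter⁺ (_∈? Q) (∈-allFin i) i∈Q))

  eval-⋀ᵛ-greatest : ∀ {m x} (Q : Subset m) → (∀ i → i Sub.∈ Q → x A.≤ 𝔞 (toℕ i)) →
                     x A.≤ eval A 𝔞 (⋀ᵛ Q)
  eval-⋀ᵛ-greatest {m} Q lower =
    eval-⋀-greatest _ (All.map⁺ (All.map (lower _) (All.all-filter (_∈? Q) (allFin m))))

-- Reduction of `ι-fun n`, for `n` at least 2, to a ternary inequality.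

module _ (A : SLO c ℓ₁ ℓ₂) where
  private module A = SLO A

  -- This is `ι-fun 2` as an inequality between three elements, up to the order of the conjuncts and
  -- trailing copies of `⊤`.
  Fun² : Set (c ⊔ ℓ₂)
  Fun² = ∀ x y z → A.◇ (y A.∧ z) A.∧ (A.◇ (x A.∧ z) A.∧ A.◇ (x A.∧ y)) A.≤ A.◇ (x A.∧ (y A.∧ z))

  -- Apply Fun² to pᵢ ∧ p₃ ∧ … ∧ pₙ for i = 0, 1, 2.
  Fun²⇒ι-fun : Fun² → ∀ m → Validatesᴬ A (ι-fun (suc (suc m)))
  Fun²⇒ι-fun fun² m 𝔞 =
    A.trans
      (A.∧-greatest (◇-pair outside inside inside ∣Q∣≡n (Vec.there Vec.here) (Vec.there (Vec.there Vec.here)))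
      (A.∧-greatest (◇-pair inside outside inside ∣Q∣≡n Vec.here (Vec.there (Vec.there Vec.here)))
                    (◇-pair inside inside outside ∣Q∣≡n Vec.here (Vec.there Vec.here))))
      (A.trans (fun² (p 0) (p 1) (p 2)) (A.◇-mono (eval-⋀ᵛ-greatest A 𝔞 Sub.⊤ (λ i _ → meet≤ i))))
    where
    sides : (s t u : Sub.Side) → Subset (suc (suc (suc m)))
    sides s t u = s Vec.∷ t Vec.∷ u Vec.∷ Sub.⊤

    rest : Subset (suc (suc (suc m)))
    rest = sides outside outside outside

    rest⊆ : ∀ {s t u} → rest Sub.⊆ sides s t u
    rest⊆ (Vec.there (Vec.there (Vec.there i∈⊤))) = Vec.there (Vec.there (Vec.there i∈⊤))

    -- The size of `sides s t u` computes to this left-hand side whichever one of the three sides is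
    -- `outside`, so one proof serves all three subsets.
    ∣Q∣≡n : suc (suc ∣ Sub.⊤ {m} ∣) ≡ suc (suc m)
    ∣Q∣≡n = cong (λ k → suc (suc k)) (∣⊤∣≡n m)

    p : ℕ → A.Carrier
    p i = 𝔞 i A.∧ eval A 𝔞 (⋀ᵛ rest)

    ⋀ᵛ≤p : ∀ s t u {i} → i Sub.∈ sides s t u →
           eval A 𝔞 (⋀ᵛ (sides s t u)) A.≤ p (toℕ i)
    ⋀ᵛ≤p s t u i∈Q = A.∧-greatest (eval-⋀ᵛ-lower A 𝔞 i∈Q)
      (eval-⋀ᵛ-greatest A 𝔞 rest λ j j∈rest →
        eval-⋀ᵛ-lower A 𝔞 {Q = sides s t u} (rest⊆ j∈rest))

    ◇-pair : ∀ s t u {i j} → ∣ sides s t u ∣ ≡ suc (suc m) →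
             i Sub.∈ sides s t u → j Sub.∈ sides s t u →
             eval A 𝔞 (SpImplication.antecedent (ι-fun (suc (suc m)))) A.≤
             A.◇ (p (toℕ i) A.∧ p (toℕ j))
    ◇-pair s t u ∣Q∣≡n i∈Q j∈Q = A.trans
      (eval-⋀-lower A 𝔞 (∈-map⁺ (λ Q → ◇ˢ ⋀ᵛ Q)
        (∈-filter⁺ (λ Q → ∣ Q ∣ ≟ suc (suc m)) (∈-allSubsets (sides s t u)) ∣Q∣≡n)))
      (A.◇-mono (A.∧-greatest (⋀ᵛ≤p s t u i∈Q) (⋀ᵛ≤p s t u j∈Q)))

    meet≤ : ∀ i → p 0 A.∧ (p 1 A.∧ p 2) A.≤ 𝔞 (toℕ {suc (suc (suc m))} i)
    meet≤ zero                = A.trans (A.x∧y≤x _ _) (A.x∧y≤x _ _)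
    meet≤ (suc zero)          = A.trans (A.x∧y≤y _ _) (A.trans (A.x∧y≤x _ _) (A.x∧y≤x _ _))
    meet≤ (suc (suc zero))    = A.trans (A.x∧y≤y _ _) (A.trans (A.x∧y≤y _ _) (A.x∧y≤x _ _))
    -- From the fourth variable on, the bound comes from the factor `⋀ᵛ rest`, here the one inside
    -- `p 0`.
    meet≤ (suc (suc (suc i))) = A.trans (A.x∧y≤x _ _) (A.trans (A.x∧y≤y _ _)
      (eval-⋀ᵛ-lower A 𝔞 {Q = rest} (Vec.there (Vec.there (Vec.there ∈⊤)))))

-- The algebra `M∞` and the axioms it validates.

data M∞ : Set where
  𝟘 𝟙  : M∞
  atom : ℕ → M∞

infix  4 _⊑_
infixr 7 _⊓_

data _⊑_ : M∞ → M∞ → Set where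
  𝟘⊑     : ∀ {x} → 𝟘 ⊑ x
  ⊑𝟙     : ∀ {x} → x ⊑ 𝟙
  ⊑-atom : ∀ {i} → atom i ⊑ atom i

_⊓_ : M∞ → M∞ → M∞
𝟘      ⊓ y      = 𝟘
𝟙      ⊓ y      = y
atom i ⊓ 𝟘      = 𝟘
atom i ⊓ 𝟙      = atom i
atom i ⊓ atom j with i ≟ j
... | yes _ = atom i
... | no  _ = 𝟘

◇∞ : M∞ → M∞
◇∞ 𝟘        = 𝟘
◇∞ 𝟙        = 𝟙
◇∞ (atom _) = 𝟙

⊑-refl : ∀ {x} → x ⊑ x
⊑-refl {𝟘}      = 𝟘⊑
⊑-refl {𝟙}      = ⊑𝟙
⊑-refl {atom _} = ⊑-atom

⊑-trans : ∀ {x y z} → x ⊑ y → y ⊑ z → x ⊑ z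
⊑-trans 𝟘⊑     _   = 𝟘⊑
⊑-trans ⊑𝟙     ⊑𝟙  = ⊑𝟙
⊑-trans ⊑-atom y⊑z = y⊑z

⊑-antisym : ∀ {x y} → x ⊑ y → y ⊑ x → x ≡ y
⊑-antisym 𝟘⊑     𝟘⊑ = refl
⊑-antisym ⊑𝟙     ⊑𝟙 = refl
⊑-antisym ⊑-atom _  = refl

⊓-lowerˡ : ∀ x y → x ⊓ y ⊑ x
⊓-lowerˡ 𝟘        y = 𝟘⊑
⊓-lowerˡ 𝟙        y = ⊑𝟙
⊓-lowerˡ (atom i) 𝟘 = 𝟘⊑
⊓-lowerˡ (atom i) 𝟙 = ⊑-atom
⊓-lowerˡ (atom i) (atom j) with i ≟ j
... | yes _ = ⊑-atom
... | no  _ = 𝟘⊑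

⊓-lowerʳ : ∀ x y → x ⊓ y ⊑ y
⊓-lowerʳ 𝟘        y = 𝟘⊑
⊓-lowerʳ 𝟙        y = ⊑-refl
⊓-lowerʳ (atom i) 𝟘 = 𝟘⊑
⊓-lowerʳ (atom i) 𝟙 = ⊑𝟙
⊓-lowerʳ (atom i) (atom j) with i ≟ j
... | yes refl = ⊑-atom
... | no  _    = 𝟘⊑

⊓-greatest : ∀ {x y z} → z ⊑ x → z ⊑ y → z ⊑ x ⊓ y
⊓-greatest 𝟘⊑     _   = 𝟘⊑
⊓-greatest ⊑𝟙     z⊑y = z⊑y
⊓-greatest ⊑-atom ⊑𝟙  = ⊑-atom
⊓-greatest {atom i} ⊑-atom ⊑-atom with i ≟ i
... | yes _  = ⊑-atom
... | no i≢i = contradiction refl i≢i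

atoms-disjoint : ∀ {i j} → i ≢ j → atom i ⊓ atom j ≡ 𝟘
atoms-disjoint {i} {j} i≢j with i ≟ j
... | yes i≡j = contradiction i≡j i≢j
... | no  _   = refl

◇∞-mono : ∀ {x y} → x ⊑ y → ◇∞ x ⊑ ◇∞ y
◇∞-mono 𝟘⊑     = 𝟘⊑
◇∞-mono ⊑𝟙     = ⊑𝟙
◇∞-mono ⊑-atom = ⊑𝟙

◇∞-refl : ∀ x → x ⊑ ◇∞ x
◇∞-refl 𝟘        = 𝟘⊑
◇∞-refl 𝟙        = ⊑𝟙
◇∞-refl (atom _) = ⊑𝟙

◇∞-trans : ∀ x → ◇∞ (◇∞ x) ⊑ ◇∞ x
◇∞-trans 𝟘        = 𝟘⊑
◇∞-trans 𝟙        = ⊑𝟙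
◇∞-trans (atom _) = ⊑𝟙

-- If `x` or `y` is `𝟘`, the left side is `𝟘`. Otherwise `◇∞ y` is `𝟙`, so the right side is `◇∞ x`,
-- which is `𝟙`.
◇∞-sym : ∀ x y → y ⊓ ◇∞ x ⊑ ◇∞ (x ⊓ ◇∞ y)
◇∞-sym x        𝟘        = 𝟘⊑
◇∞-sym 𝟘        𝟙        = 𝟘⊑
◇∞-sym 𝟙        𝟙        = ⊑𝟙
◇∞-sym (atom _) 𝟙        = ⊑𝟙
◇∞-sym 𝟘        (atom _) = 𝟘⊑
◇∞-sym 𝟙        (atom _) = ⊑𝟙
◇∞-sym (atom _) (atom _) = ⊑𝟙

-- An argument `𝟘` makes some conjunct on the left `𝟘`. If an argument is `𝟙`, the triple meet is
-- the meet of the other two, whose `◇∞` is already a conjunct. Three atoms with nonzero pairwise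
-- meets coincide.
◇∞-fun² : ∀ x y z → ◇∞ (y ⊓ z) ⊓ (◇∞ (x ⊓ z) ⊓ ◇∞ (x ⊓ y)) ⊑ ◇∞ (x ⊓ (y ⊓ z))
◇∞-fun² 𝟘        y z = ⊑-trans (⊓-lowerʳ (◇∞ (y ⊓ z)) 𝟘) 𝟘⊑
◇∞-fun² 𝟙        y z = ⊓-lowerˡ (◇∞ (y ⊓ z)) _
◇∞-fun² (atom i) 𝟘 z = 𝟘⊑
◇∞-fun² (atom i) 𝟙 z =
  ⊑-trans (⊓-lowerʳ (◇∞ z) _) (⊓-lowerˡ (◇∞ (atom i ⊓ z)) 𝟙)
◇∞-fun² (atom i) (atom j) 𝟘 = 𝟘⊑
◇∞-fun² (atom i) (atom j) 𝟙 = ⊑-refl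
◇∞-fun² (atom i) (atom j) (atom k) with j ≟ k
... | no _ = 𝟘⊑
... | yes refl with i ≟ j
...   | no _  = 𝟘⊑
...   | yes _ = ⊑𝟙

-- Carrier, equality and order are lifted separately, so that the counterexample is available at
-- every choice of levels.
M∞-SLO : ∀ c ℓ₁ ℓ₂ → SLO c ℓ₁ ℓ₂
M∞-SLO c ℓ₁ ℓ₂ = record
  { boundedMeetSemilattice = record
    { Carrier = Lift c M∞
    ; _≈_     = λ x y → Lift ℓ₁ (lower x ≡ lower y)
    ; _≤_     = λ x y → Lift ℓ₂ (lower x ⊑ lower y)
    ; _∧_     = λ x y → lift (lower x ⊓ lower y)
    ; ⊤       = lift 𝟙
    ; isBoundedMeetSemilattice = record
      { isMeetSemilattice = record
        { isPartialOrder = record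
          { isPreorder = record
            { isEquivalence = record
              { refl  = lift refl
              ; sym   = λ p → lift (sym (lower p))
              ; trans = λ p q → lift (trans (lower p) (lower q))
              }
            ; reflexive = λ { (lift refl) → lift ⊑-refl }
            ; trans     = λ p q → lift (⊑-trans (lower p) (lower q))
            }
          ; antisym = λ p q → lift (⊑-antisym (lower p) (lower q))
          }
        ; infimum = λ x y → lift (⊓-lowerˡ (lower x) (lower y))
                          , lift (⊓-lowerʳ (lower x) (lower y))
                          , λ _ p q → lift (⊓-greatest (lower p) (lower q))
        }
      ; maximum = λ _ → lift ⊑𝟙
      }
    }
  ; ◇      = λ x → lift (◇∞ (lower x))
  ; ◇-mono = λ p → lift (◇∞-mono (lower p))
  }

M∞-ι-fun : ∀ m → Validatesᴬ (M∞-SLO c ℓ₁ ℓ₂) (ι-fun (suc (suc m)))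
M∞-ι-fun = Fun²⇒ι-fun (M∞-SLO _ _ _) λ x y z → lift (◇∞-fun² (lower x) (lower y) (lower z))

-- This is the largest of the five axiom sets; the other four are subsets of it.
M∞-validates : ∀ m → ValidatesAllᴬ (M∞-SLO c ℓ₁ ℓ₂) (Σ-equiv ∪ ｛ ι-fun (suc (suc m)) ｝)
M∞-validates m _ (inj₁ (inj₁ refl))        𝔞 = lift (◇∞-refl (lower (𝔞 0)))
M∞-validates m _ (inj₁ (inj₂ (inj₁ refl))) 𝔞 = lift (◇∞-trans (lower (𝔞 0)))
M∞-validates m _ (inj₁ (inj₂ (inj₂ refl))) 𝔞 = lift (◇∞-sym (lower (𝔞 0)) (lower (𝔞 1)))
M∞-validates m _ (inj₂ refl)               𝔞 = M∞-ι-fun m 𝔞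

-- Frames validating `ι-fun n`, and the failure of embeddings.

module _ (𝔉 : Frame f) (V : ℕ → Pred (Frame.W 𝔉) f) (w : Frame.W 𝔉) where

  forces-⋀⁺ : ∀ Γ → All (Forces 𝔉 V w) Γ → Forces 𝔉 V w (⋀ Γ)
  forces-⋀⁺ []      []       = tt
  forces-⋀⁺ (σ ∷ Γ) (p ∷ ps) = p , forces-⋀⁺ Γ ps

  forces-⋀⁻ : ∀ {σ Γ} → Forces 𝔉 V w (⋀ Γ) → σ ∈ Γ → Forces 𝔉 V w σ
  forces-⋀⁻ (p , _)  (here refl) = p
  forces-⋀⁻ (_ , ps) (there σ∈Γ) = forces-⋀⁻ ps σ∈Γ

  forces-⋀ᵛ⁺ : ∀ {m} (Q : Subset m) → (∀ i → i Sub.∈ Q → w ∈ᵖ V (toℕ i)) → Forces 𝔉 V w (⋀ᵛ Q)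
  forces-⋀ᵛ⁺ {m} Q w∈V =
    forces-⋀⁺ _ (All.map⁺ (All.map (w∈V _) (All.all-filter (_∈? Q) (allFin m))))

  forces-⋀ᵛ⁻ : ∀ {m} {Q : Subset m} {i} → Forces 𝔉 V w (⋀ᵛ Q) → i Sub.∈ Q → w ∈ᵖ V (toℕ i)
  forces-⋀ᵛ⁻ {Q = Q} {i} w⊩Q i∈Q =
    forces-⋀⁻ w⊩Q (∈-map⁺ (var ∘ toℕ) (∈-filter⁺ (_∈? Q) (∈-allFin i) i∈Q))

-- Evaluate pᵢ as the union of the X k with k ≠ i: a point in X k then satisfies every n-element
-- Q ⊆ P omitting p_k, while a point satisfying all of P lies in two different X's.
ι-fun-pigeonhole : ∀ (𝔉 : Frame f) n → Validatesᶠ 𝔉 (ι-fun n) →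
  (X : Fin (suc n) → Pred (Frame.W 𝔉) f) (w : Frame.W 𝔉) →
  (∀ i → w ∈ᵖ ◇⁺ 𝔉 (X i)) →
  ∃[ u ] (Frame.R 𝔉 w u × ∃[ i ] ∃[ j ] (i ≢ j × u ∈ᵖ X i × u ∈ᵖ X j))
ι-fun-pigeonhole {f} 𝔉 n valid X w w∈◇X = collide (valid V w antecedent)
  where
  open Frame 𝔉

  V : ℕ → Pred W f
  V i u = ∃[ k ] (toℕ k ≢ i × u ∈ᵖ X k)

  ◇Q : ∀ Q → ∣ Q ∣ ≡ n → Forces 𝔉 V w (◇ˢ ⋀ᵛ Q)
  ◇Q Q ∣Q∣≡n with ∣Q∣≡n⇒∃∉ Q ∣Q∣≡n
  ... | k , k∉Q with w∈◇X k
  ...   | v , v∈Xk , wRv = v , wRv , forces-⋀ᵛ⁺ 𝔉 V v Q λ i i∈Q →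
            k , (λ k≡i → k∉Q (subst (Sub._∈ Q) (sym (Fin.toℕ-injective k≡i)) i∈Q)) , v∈Xk

  antecedent : Forces 𝔉 V w (SpImplication.antecedent (ι-fun n))
  antecedent = forces-⋀⁺ 𝔉 V w _
    (All.map⁺ (All.map (λ {Q} → ◇Q Q) (All.all-filter (λ Q → ∣ Q ∣ ≟ n) (allSubsets (suc n)))))

  collide : Forces 𝔉 V w (◇ˢ ⋀ᵛ (Sub.⊤ {suc n})) →
            ∃[ u ] (R w u × ∃[ i ] ∃[ j ] (i ≢ j × u ∈ᵖ X i × u ∈ᵖ X j))
  -- The first variable only serves to find some `i` with `u` in `X i`. The variable with that very
  -- index `i` then yields a second index, different from `i`.
  collide (u , wRu , u⊩P) with forces-⋀ᵛ⁻ 𝔉 V u {Q = Sub.⊤ {suc n}} {zero} u⊩P ∈⊤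
  ... | i , _ , u∈Xi with forces-⋀ᵛ⁻ 𝔉 V u {Q = Sub.⊤} {i} u⊩P ∈⊤
  ...   | j , j≢i , u∈Xj = u , wRu , i , j , (λ i≡j → j≢i (cong toℕ (sym i≡j))) , u∈Xi , u∈Xj

-- The argument is direct: every point is shown to lie in the image of `𝟘`. Hence `𝟘` and `𝟙` have
-- the same image, against injectivity.
M∞-not-embeddable : ∀ (𝔉 : Frame f) n → Validatesᶠ 𝔉 (ι-fun n) → ¬ Embedding (M∞-SLO c ℓ₁ ℓ₂) (𝔉 ⋆)
M∞-not-embeddable {f} {c} {ℓ₁} {ℓ₂} 𝔉 n valid η = contradiction (lower 𝟙≈𝟘) λ ()
  where
  open Frame 𝔉
  open Embedding η renaming (cong to η-cong)

  img : M∞ → Pred W f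
  img x = to (lift x)

  -- As `◇∞ (atom i)` is `𝟙`, its image is the whole frame.
  ◇atom : ∀ w i → w ∈ᵖ ◇⁺ 𝔉 (img (atom i))
  ◇atom w i = proj₁ (◇-homo (lift (atom i))) (proj₂ ⊤-homo tt)

  everywhere-𝟘 : ∀ w → w ∈ᵖ img 𝟘
  everywhere-𝟘 w with ι-fun-pigeonhole 𝔉 n valid (img ∘ atom ∘ toℕ) w (◇atom w ∘ toℕ)
  -- As `◇∞ 𝟘` is `𝟘`, the image of `𝟘` contains every predecessor of its points, so it suffices
  -- that `u` lies in it.
  ... | u , wRu , i , j , i≢j , u∈i , u∈j = proj₂ (◇-homo (lift 𝟘)) (u , u∈𝟘 , wRu)
    where
    u∈𝟘 : u ∈ᵖ img 𝟘
    u∈𝟘 = proj₁ (η-cong (lift (atoms-disjoint (i≢j ∘ Fin.toℕ-injective))))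
            (proj₂ (∧-homo (lift (atom (toℕ i))) (lift (atom (toℕ j)))) (u∈i , u∈j))

  𝟙≈𝟘 : Lift ℓ₁ (𝟙 ≡ 𝟘)
  𝟙≈𝟘 = injective ((λ {w} _ → everywhere-𝟘 w) , λ _ → proj₂ ⊤-homo tt)

-- Passage from axiom sets to the logics they generate.

not-complex : ∀ c ℓ₁ ℓ₂ f m {Γ : Pred SpImplication 0ℓ} →
  ι-fun (suc (suc m)) ∈ᵖ Γ → Γ ⊆ᵖ (Σ-equiv ∪ ｛ ι-fun (suc (suc m)) ｝) →
  ¬ Complex c ℓ₁ ℓ₂ f (SPi+ c ℓ₁ ℓ₂ Γ)
not-complex c ℓ₁ ℓ₂ f m fun∈Γ Γ⊆ complex
  -- Membership in the logic is instantiated at `M∞` itself, a model of `Γ` by the upper bound on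
  -- `Γ`. The axiom `ι-fun` belongs to the logic, so the resulting frame validates it.
  with complex (M∞-SLO c ℓ₁ ℓ₂) (λ ι ι∈L → ι∈L (M∞-SLO c ℓ₁ ℓ₂) λ κ κ∈Γ → M∞-validates m κ (Γ⊆ κ∈Γ))
... | 𝔉 , valid , η =
  M∞-not-embeddable 𝔉 (suc (suc m)) (valid (ι-fun (suc (suc m))) λ A A⊨Γ → A⊨Γ (ι-fun (suc (suc m))) fun∈Γ) η

theorem7p2 : ∀ (c ℓ₁ ℓ₂ f : Level) (n : ℕ) → 2 ≤ n →
    ¬ Complex c ℓ₁ ℓ₂ f (SPi+ c ℓ₁ ℓ₂ ｛ ι-fun n ｝)
    × ¬ Complex c ℓ₁ ℓ₂ f (SPi+ c ℓ₁ ℓ₂ (｛ ι-refl ｝ ∪ ｛ ι-fun n ｝))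
    × ¬ Complex c ℓ₁ ℓ₂ f (SPi+ c ℓ₁ ℓ₂ (｛ ι-trans ｝ ∪ ｛ ι-fun n ｝))
    × ¬ Complex c ℓ₁ ℓ₂ f (SPi+ c ℓ₁ ℓ₂ (Σ-qo ∪ ｛ ι-fun n ｝))
    × ¬ Complex c ℓ₁ ℓ₂ f (SPi+ c ℓ₁ ℓ₂ (Σ-equiv ∪ ｛ ι-fun n ｝))
theorem7p2 c ℓ₁ ℓ₂ f (suc (suc m)) (s≤s (s≤s _)) =
    not-complex c ℓ₁ ℓ₂ f m refl inj₂
  , not-complex c ℓ₁ ℓ₂ f m (inj₂ refl)
      (λ { (inj₁ p) → inj₁ (inj₁ p) ; (inj₂ p) → inj₂ p })
  , not-complex c ℓ₁ ℓ₂ f m (inj₂ refl)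
      (λ { (inj₁ p) → inj₁ (inj₂ (inj₁ p)) ; (inj₂ p) → inj₂ p })
  , not-complex c ℓ₁ ℓ₂ f m (inj₂ refl)
      (λ { (inj₁ (inj₁ p)) → inj₁ (inj₁ p) ; (inj₁ (inj₂ p)) → inj₁ (inj₂ (inj₁ p)) ; (inj₂ p) → inj₂ p })
  , not-complex c ℓ₁ ℓ₂ f m (inj₂ refl) (λ p → p)
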